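{- Let $t \ge 1$ and $k \ge t+1$ be integers. For each $i$ with $0 \le i \le t+1$, put $s_i = 2^{t+1} - 2^{(t+1)-i}$. Then for each such $i$ there exists (for some positive integer $v$) a $t$-$(v,k)$ Latin trade of volume $s_i$.
   Context: Let $t \le k$ and $v$ be positive integers, $V = \{1,\dots,v\}$, and let $V^k$ be the set of ordered $k$-tuples of elements of $V$. For a $t$-subset $I = \{i_1 < \cdots < i_t\}$ of $\{1,\dots,k\}$ and $(u_1,\dots,u_t) \in V^t$, the tuple $(x_1,\dots,x_k) \in V^k$ is said to contain $(u_1,\dots,u_t)_I$ if $x_{i_j} = u_j$ for all $j = 1,\dots,t$. A $t$-$(v,k)$ Latin trade of volume $s$ is a pair $T = (T_1,T_2)$ of disjoint collections (finite multisets, i.e. repeated elements are allowed; disjoint means no tuple occurs in both), each consisting of $s$ elements of $V^k$ counted with multiplicity, such that for each $t$-subset $I \subseteq \{1,\dots,k\}$ and each $(u_1,\dots,u_t) \in V^t$, the number of elements (with multiplicity) of $T_1$ containing $(u_1,\dots,u_t)_I$ equals the number of elements of $T_2$ containing $(u_1,\dots,u_t)_I$. The trade with $T_1 = T_2 = \emptyset$ (volume $0$) is allowed and is called trivial. -}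

module Defs where

open import Data.Nat.Base using (ℕ)
open import Data.Fin.Base using (Fin; _<_)
open import Data.Fin.Properties using (_≟_; all?)
open import Data.List.Base using (List; length; filter)
open import Data.List.Relation.Binary.Disjoint.Propositional using (Disjoint)
open import Data.Vec.Base using (Vec; lookup)
open import Relation.Binary.Core using (_Preserves_⟶_)
open import Relation.Binary.PropositionalEquality.Core using (_≡_)
open import Relation.Nullary.Decidable.Core using (Dec)

-- A t-subset {i₁ < ⋯ < iₜ} of the k coordinates, given by its increasing
-- enumeration j ↦ iⱼ.
record SubsetOfSize (t k : ℕ) : Set where
  field
    index      : Fin t → Fin k
    increasing : index Preserves _<_ ⟶ _<_

open SubsetOfSize public

Contains : {t v k : ℕ} → SubsetOfSize t k → Vec (Fin v) t → Vec (Fin v) k → Set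
Contains I u x = ∀ j → lookup x (index I j) ≡ lookup u j

contains? : {t v k : ℕ} (I : SubsetOfSize t k) (u : Vec (Fin v) t) (x : Vec (Fin v) k) →
            Dec (Contains I u x)
contains? I u x = all? (λ j → lookup x (index I j) ≟ lookup u j)

-- Multiplicities count: a tuple occurring m times in the list contributes m.
countContaining : {t v k : ℕ} → SubsetOfSize t k → Vec (Fin v) t →
                  List (Vec (Fin v) k) → ℕ
countContaining I u T = length (filter (contains? I u) T)

-- t-(v,k) Latin trades of volume s. Finite multisets are represented by lists;
-- no condition below depends on the order of the entries.
record LatinTrade (t v k s : ℕ) : Set where
  field
    T₁ T₂    : List (Vec (Fin v) k)
    disjoint : Disjoint T₁ T₂
    volume₁  : length T₁ ≡ s
    volume₂  : length T₂ ≡ s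
    balanced : (I : SubsetOfSize t k) (u : Vec (Fin v) t) →
               countContaining I u T₁ ≡ countContaining I u T₂

{-# OPTIONS --safe #-}
-- View a pair (T₁ , T₂) as an integer combination T₁ − T₂ of tuples over {0,1,2},
-- with juxtaposition of tuples as product. Put Dᵢ⁽ᶜ⁾ = (0 − c)ⁱ and
-- Eᵢ = Dᵢ⁽¹⁾ − Dᵢ⁽²⁾. In Eᵢ only the all-zero tuple cancels, so each of its two
-- sides has 2ⁱ − 1 tuples, and (0 − 1)ᵐ · Eᵢ has volume 2ᵐ (2ⁱ − 1). A product of
-- m + i = t + 1 such factors vanishes when summed along any of its t + 1
-- coordinates, hence is t-balanced; the remaining k − (t + 1) coordinates are
-- held constant.
module Submission where

open import Defs
open import Data.Fin.Base using (Fin; zero; suc; _↑ˡ_)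
open import Data.Fin.Patterns using (0F; 1F; 2F)
open import Data.Fin.Properties using (_≟_; any?; ¬∀⟶∃¬; <⇒notInjective; ↑ˡ-injective)
open import Data.List.Base using (List; []; _∷_; [_]; _++_; map; length; filter)
open import Data.List.Membership.Propositional using (_∈_)
open import Data.List.Membership.Propositional.Properties using (∈-++⁻; ∈-map⁻)
open import Data.List.Properties using (filter-++; filter-≐; length-++; length-map)
open import Data.List.Relation.Binary.Disjoint.Propositional using (Disjoint)
import Data.List.Relation.Binary.Disjoint.Propositional.Properties as Disjoint
open import Data.Nat using (ℕ; zero; suc; _+_; _∸_; _^_; _≤_; _<_; s≤s; z≤n)
open import Data.Nat.Properties
  using (+-identityʳ; +-comm; +-cancelʳ-≡; m+n∸n≡m; m+[n∸m]≡n; m∸n+n≡m; ≤-reflexive)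
open import Data.Nat.Tactic.RingSolver using (solve-∀)
open import Data.Product using (_×_; ∃-syntax; _,_; proj₁; proj₂)
open import Data.Sum using (inj₁; inj₂)
open import Data.Vec.Base using (Vec; _∷_; replicate; lookup; _[_]≔_)
open import Data.Vec.Properties using (lookup∘update′)
open import Function using (_∘_)
open import Level using (0ℓ)
open import Relation.Binary.PropositionalEquality
  using (_≡_; _≢_; refl; sym; trans; cong; cong₂; subst; module ≡-Reasoning)
open import Relation.Nullary using (yes; no; contradiction)
open import Relation.Unary using (Pred; Decidable)

private variable
  n : ℕ

-- Lists of tuples grouped by first entry.

Tuple : ℕ → Set
Tuple = Vec (Fin 3)

module _ {A : Set} {P : Pred A 0ℓ} (P? : Decidable P) where

  count : List A → ℕ
  count = length ∘ filter P?

  count-++ : ∀ xs ys → count (xs ++ ys) ≡ count xs + count ys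
  count-++ xs ys = trans (cong length (filter-++ P? xs ys)) (length-++ (filter P? xs))

count-map : {A B : Set} {P : Pred B 0ℓ} (P? : Decidable P) (f : A → B) (xs : List A) →
            count P? (map f xs) ≡ count (P? ∘ f) xs
count-map P? f [] = refl
count-map P? f (x ∷ xs) with P? (f x)
... | yes _ = cong suc (count-map P? f xs)
... | no  _ = count-map P? f xs

prefixed : (Fin 3 → List (Tuple n)) → List (Tuple (suc n))
prefixed f = map (0F ∷_) (f 0F) ++ map (1F ∷_) (f 1F) ++ map (2F ∷_) (f 2F)

count-prefixed : {P : Pred (Tuple (suc n)) 0ℓ} (P? : Decidable P) (f : Fin 3 → List (Tuple n)) →
                 count P? (prefixed f) ≡
                 count (P? ∘ (0F ∷_)) (f 0F) +
                 (count (P? ∘ (1F ∷_)) (f 1F) + count (P? ∘ (2F ∷_)) (f 2F))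
count-prefixed P? f =
  trans (count-++ P? (map (0F ∷_) (f 0F)) _)
    (cong₂ _+_ (count-map P? (0F ∷_) (f 0F))
      (trans (count-++ P? (map (1F ∷_) (f 1F)) _)
        (cong₂ _+_ (count-map P? (1F ∷_) (f 1F)) (count-map P? (2F ∷_) (f 2F)))))

length-prefixed : (f : Fin 3 → List (Tuple n)) →
                  length (prefixed f) ≡ length (f 0F) + (length (f 1F) + length (f 2F))
length-prefixed f =
  trans (length-++ (map (0F ∷_) (f 0F)))
    (cong₂ _+_ (length-map (0F ∷_) (f 0F))
      (trans (length-++ (map (1F ∷_) (f 1F)))
        (cong₂ _+_ (length-map (1F ∷_) (f 1F)) (length-map (2F ∷_) (f 2F)))))

-- The three blocks have different heads, so the head of a member tells which block it came from.
-- This reduces disjointness of grouped lists to disjointness block by block.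
tail∈ : (f : Fin 3 → List (Tuple n)) {a : Fin 3} {x : Tuple n} → a ∷ x ∈ prefixed f → x ∈ f a
tail∈ f p with ∈-++⁻ (map (0F ∷_) (f 0F)) p
... | inj₁ q with _ , r , refl ← ∈-map⁻ (0F ∷_) q = r
... | inj₂ p′ with ∈-++⁻ (map (1F ∷_) (f 1F)) p′
...   | inj₁ q with _ , r , refl ← ∈-map⁻ (1F ∷_) q = r
...   | inj₂ q with _ , r , refl ← ∈-map⁻ (2F ∷_) q = r

prefixed-disjoint : {f g : Fin 3 → List (Tuple n)} → (∀ a → Disjoint (f a) (g a)) →
                    Disjoint (prefixed f) (prefixed g)
prefixed-disjoint {f = f} {g} dis {a ∷ x} (p , q) = dis a (tail∈ f p , tail∈ g q)

-- Signed combinations of tuples, kept as two lists with no automatic cancellation.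

record Signed (n : ℕ) : Set where
  constructor _⊖_
  field
    pos neg : List (Tuple n)

open Signed

negate : Signed n → Signed n
negate (xs ⊖ ys) = ys ⊖ xs

branch : (Fin 3 → Signed n) → Signed (suc n)
branch f = prefixed (pos ∘ f) ⊖ prefixed (neg ∘ f)

∅ : Signed n
∅ = [] ⊖ []

_⟨_⟩ : {A : Set} → A → A × A → Fin 3 → A
(a ⟨ b , c ⟩) 0F = a
(a ⟨ b , c ⟩) 1F = b
(a ⟨ b , c ⟩) 2F = c

-- Left multiplication by 0 - 1 and by 0 - 2; a minus sign becomes an exchange of sides.
[0−1]·_ [0−2]·_ : Signed n → Signed (suc n)
[0−1]· S = branch (S ⟨ negate S , ∅ ⟩)
[0−2]· S = branch (S ⟨ ∅ , negate S ⟩)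

-- Balance along a single coordinate.

Ignores : Fin n → Pred (Tuple n) 0ℓ → Set
Ignores j P = ∀ x a → P x → P (x [ j ]≔ a)

-- Vanishing of the sum along coordinate `j`, expressed through test predicates blind to `j`.
-- Letting `P` vary allows induction to pass to `P? ∘ (a ∷_)`, and `contains? I u` to be substituted
-- at the end.
Balanced : Fin n → Signed n → Set₁
Balanced j S = ∀ {P} (P? : Decidable P) → Ignores j P → count P? (pos S) ≡ count P? (neg S)

balanced-negate : {j : Fin n} {S : Signed n} → Balanced j S → Balanced j (negate S)
balanced-negate bal P? ign = sym (bal P? ign)

balanced-branch : {j : Fin n} {f : Fin 3 → Signed n} → (∀ a → Balanced j (f a)) →
                  Balanced (suc j) (branch f)
balanced-branch {j = j} {f} bal {P} P? ign = begin
  count P? (prefixed (pos ∘ f))  ≡⟨ count-prefixed P? (pos ∘ f) ⟩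
  _                              ≡⟨ cong₂ _+_ (slice 0F) (cong₂ _+_ (slice 1F) (slice 2F)) ⟩
  _                              ≡⟨ count-prefixed P? (neg ∘ f) ⟨
  count P? (prefixed (neg ∘ f))  ∎
  where
  open ≡-Reasoning
  slice : ∀ a → count (P? ∘ (a ∷_)) (pos (f a)) ≡ count (P? ∘ (a ∷_)) (neg (f a))
  slice a = bal a (P? ∘ (a ∷_)) (λ x b → ign (a ∷ x) b)

count-ignoring-head : {P : Pred (Tuple (suc n)) 0ℓ} (P? : Decidable P) → Ignores zero P →
                      ∀ a b xs → count (P? ∘ (a ∷_)) xs ≡ count (P? ∘ (b ∷_)) xs
count-ignoring-head P? ign a b xs =
  cong length (filter-≐ (P? ∘ (a ∷_)) (P? ∘ (b ∷_))
    ((λ {x} → ign (a ∷ x) b) , (λ {x} → ign (b ∷ x) a)) xs)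

-- A predicate blind to the head cannot separate the copy of `S` with head 0 from the copy of
-- `negate S` with head 1, so the two cancel whatever `S` is.
[0−1]·-balanced-head : (S : Signed n) → Balanced zero ([0−1]· S)
[0−1]·-balanced-head S@(xs ⊖ ys) P? ign = begin
  count P? (pos ([0−1]· S))  ≡⟨ count-prefixed P? (pos ∘ (S ⟨ negate S , ∅ ⟩)) ⟩
  x₀ + (y₁ + 0)              ≡⟨ cong₂ (λ a b → a + (b + 0))
                                  (count-ignoring-head P? ign 0F 1F xs)
                                  (count-ignoring-head P? ign 1F 0F ys) ⟩
  x₁ + (y₀ + 0)              ≡⟨ swap x₁ y₀ ⟩
  y₀ + (x₁ + 0)              ≡⟨ count-prefixed P? (neg ∘ (S ⟨ negate S , ∅ ⟩)) ⟨
  count P? (neg ([0−1]· S))  ∎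
  where
  open ≡-Reasoning
  x₀ = count (P? ∘ (0F ∷_)) xs
  x₁ = count (P? ∘ (1F ∷_)) xs
  y₀ = count (P? ∘ (0F ∷_)) ys
  y₁ = count (P? ∘ (1F ∷_)) ys
  swap : ∀ a b → a + (b + 0) ≡ b + (a + 0)
  swap = solve-∀

[0−2]·-balanced-head : (S : Signed n) → Balanced zero ([0−2]· S)
[0−2]·-balanced-head S@(xs ⊖ ys) P? ign = begin
  count P? (pos ([0−2]· S))  ≡⟨ count-prefixed P? (pos ∘ (S ⟨ ∅ , negate S ⟩)) ⟩
  x₀ + y₂                    ≡⟨ cong₂ _+_ (count-ignoring-head P? ign 0F 2F xs)
                                          (count-ignoring-head P? ign 2F 0F ys) ⟩
  x₂ + y₀                    ≡⟨ +-comm x₂ y₀ ⟩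
  y₀ + x₂                    ≡⟨ count-prefixed P? (neg ∘ (S ⟨ ∅ , negate S ⟩)) ⟨
  count P? (neg ([0−2]· S))  ∎
  where
  open ≡-Reasoning
  x₀ = count (P? ∘ (0F ∷_)) xs
  x₂ = count (P? ∘ (2F ∷_)) xs
  y₀ = count (P? ∘ (0F ∷_)) ys
  y₂ = count (P? ∘ (2F ∷_)) ys

[0−1]·-balanced : {S : Signed n} {j : Fin n} → Balanced j S → Balanced (suc j) ([0−1]· S)
[0−1]·-balanced {S = S} bal = balanced-branch {f = S ⟨ negate S , ∅ ⟩} λ where
  0F → bal
  1F → balanced-negate {S = S} bal
  2F → λ _ _ → refl

[0−2]·-balanced : {S : Signed n} {j : Fin n} → Balanced j S → Balanced (suc j) ([0−2]· S)
[0−2]·-balanced {S = S} bal = balanced-branch {f = S ⟨ ∅ , negate S ⟩} λ where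
  0F → bal
  1F → λ _ _ → refl
  2F → balanced-negate {S = S} bal

-- Disjointness of the two sides.

DisjointSides : Signed n → Set
DisjointSides S = Disjoint (pos S) (neg S)

∅-disjoint : DisjointSides (∅ {n})
∅-disjoint ((), _)

branch-disjoint : {f : Fin 3 → Signed n} → (∀ a → DisjointSides (f a)) → DisjointSides (branch f)
branch-disjoint {f = f} dis = prefixed-disjoint {f = pos ∘ f} {g = neg ∘ f} dis

[0−1]·-disjoint : {S : Signed n} → DisjointSides S → DisjointSides ([0−1]· S)
[0−1]·-disjoint {S = S} dis = branch-disjoint {f = S ⟨ negate S , ∅ ⟩} λ where
  0F → dis
  1F → Disjoint.sym dis
  2F → ∅-disjoint

[0−2]·-disjoint : {S : Signed n} → DisjointSides S → DisjointSides ([0−2]· S)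
[0−2]·-disjoint {S = S} dis = branch-disjoint {f = S ⟨ ∅ , negate S ⟩} λ where
  0F → dis
  1F → ∅-disjoint
  2F → Disjoint.sym dis

-- r is the number of trailing coordinates that are held constant.
module Construction (r : ℕ) where

  -- The powers `D¹`, `D²` and their reduced difference `E`.

  D¹ D² E : (i : ℕ) → Signed (i + r)

  D¹ zero    = [ replicate r 0F ] ⊖ []
  D¹ (suc i) = [0−1]· D¹ i

  D² zero    = [ replicate r 0F ] ⊖ []
  D² (suc i) = [0−2]· D² i

  -- D¹ᵢ₊₁ − D²ᵢ₊₁ = (0 · D¹ᵢ − 1 · D¹ᵢ) − (0 · D²ᵢ − 2 · D²ᵢ), grouped by first entry.
  E zero    = ∅
  E (suc i) = branch (E i ⟨ negate (D¹ i) , D² i ⟩)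

  D¹-balanced : ∀ i (j : Fin i) → Balanced (j ↑ˡ r) (D¹ i)
  D¹-balanced (suc i) zero    = [0−1]·-balanced-head (D¹ i)
  D¹-balanced (suc i) (suc j) = [0−1]·-balanced {S = D¹ i} (D¹-balanced i j)

  D²-balanced : ∀ i (j : Fin i) → Balanced (j ↑ˡ r) (D² i)
  D²-balanced (suc i) zero    = [0−2]·-balanced-head (D² i)
  D²-balanced (suc i) (suc j) = [0−2]·-balanced {S = D² i} (D²-balanced i j)

  -- E = D¹ − D², with both sides moved so that no subtraction occurs.
  E-difference : ∀ i {P : Pred (Tuple (i + r)) 0ℓ} (P? : Decidable P) →
                 count P? (pos (E i)) + (count P? (neg (D¹ i)) + count P? (pos (D² i))) ≡
                 count P? (neg (E i)) + (count P? (pos (D¹ i)) + count P? (neg (D² i)))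
  E-difference zero    P? = sym (+-identityʳ _)
  E-difference (suc i) P?
    rewrite count-prefixed P? (pos ∘ (E i ⟨ negate (D¹ i) , D² i ⟩))
          | count-prefixed P? (neg ∘ (E i ⟨ negate (D¹ i) , D² i ⟩))
          | count-prefixed P? (pos ∘ (D¹ i ⟨ negate (D¹ i) , ∅ ⟩))
          | count-prefixed P? (neg ∘ (D¹ i ⟨ negate (D¹ i) , ∅ ⟩))
          | count-prefixed P? (pos ∘ (D² i ⟨ ∅ , negate (D² i) ⟩))
          | count-prefixed P? (neg ∘ (D² i ⟨ ∅ , negate (D² i) ⟩))
          -- Both sides contain all four of `x₁`, `y₁`, `x₂`, `y₂`; what remains is the induction
          -- hypothesis for tuples with head 0.
          = trans (left (c₀ (pos (E i))) (c₀ (neg (D¹ i))) (c₀ (pos (D² i))) x₁ y₁ x₂ y₂)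
              (trans (cong (_+ (x₁ + y₁ + x₂ + y₂)) (E-difference i (P? ∘ (0F ∷_))))
                (right (c₀ (neg (E i))) (c₀ (pos (D¹ i))) (c₀ (neg (D² i))) x₁ y₁ x₂ y₂))
    where
    c₀ = count (P? ∘ (0F ∷_))
    x₁ = count (P? ∘ (1F ∷_)) (pos (D¹ i))
    y₁ = count (P? ∘ (1F ∷_)) (neg (D¹ i))
    x₂ = count (P? ∘ (2F ∷_)) (pos (D² i))
    y₂ = count (P? ∘ (2F ∷_)) (neg (D² i))
    left : ∀ e a b x₁ y₁ x₂ y₂ →
           e + (y₁ + x₂) + (a + (x₁ + 0) + (b + y₂)) ≡ e + (a + b) + (x₁ + y₁ + x₂ + y₂)
    left = solve-∀
    right : ∀ e a b x₁ y₁ x₂ y₂ →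
            e + (a + b) + (x₁ + y₁ + x₂ + y₂) ≡ e + (x₁ + y₂) + (a + (y₁ + 0) + (b + x₂))
    right = solve-∀

  -- The slices of `E` by head differ, so balance along the head is not visible slicewise. It is
  -- inherited from `D¹` and `D²`, whose contributions to `E-difference` agree and cancel.
  E-balanced : ∀ i (j : Fin i) → Balanced (j ↑ˡ r) (E i)
  E-balanced i j P? ign = +-cancelʳ-≡ _ (count P? (pos (E i))) (count P? (neg (E i)))
    (trans (E-difference i P?) (cong (count P? (neg (E i)) +_)
      (cong₂ _+_ (D¹-balanced i j P? ign) (sym (D²-balanced i j P? ign)))))

  D¹-disjoint : ∀ i → DisjointSides (D¹ i)
  D¹-disjoint zero    (_ , ())
  D¹-disjoint (suc i) = [0−1]·-disjoint {S = D¹ i} (D¹-disjoint i)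

  D²-disjoint : ∀ i → DisjointSides (D² i)
  D²-disjoint zero    (_ , ())
  D²-disjoint (suc i) = [0−2]·-disjoint {S = D² i} (D²-disjoint i)

  E-disjoint : ∀ i → DisjointSides (E i)
  E-disjoint zero    = ∅-disjoint
  E-disjoint (suc i) = branch-disjoint {f = E i ⟨ negate (D¹ i) , D² i ⟩} λ where
    0F → E-disjoint i
    1F → Disjoint.sym (D¹-disjoint i)
    2F → D²-disjoint i

  -- These mixed sums are what one step adds to the two sides of `E`. Unlike the length of a single
  -- side, they follow one formula from `i = 0` on.
  length-D : ∀ i → length (neg (D¹ i)) + length (pos (D² i)) ≡ 2 ^ i ×
                   length (pos (D¹ i)) + length (neg (D² i)) ≡ 2 ^ i
  length-D zero = refl , refl
  length-D (suc i)
    rewrite length-prefixed (pos ∘ (D¹ i ⟨ negate (D¹ i) , ∅ ⟩))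
          | length-prefixed (neg ∘ (D¹ i ⟨ negate (D¹ i) , ∅ ⟩))
          | length-prefixed (pos ∘ (D² i ⟨ ∅ , negate (D² i) ⟩))
          | length-prefixed (neg ∘ (D² i ⟨ ∅ , negate (D² i) ⟩))
    with p , q ← length-D i =
      trans (regroup (length (neg (D¹ i))) _ _ _) (cong₂ (λ a b → a + (b + 0)) p q) ,
      trans (regroup (length (pos (D¹ i))) _ _ _) (cong₂ (λ a b → a + (b + 0)) q p)
    where
    regroup : ∀ a b c d → a + (b + 0) + (c + d) ≡ a + c + (b + d + 0)
    regroup = solve-∀

  -- The added 1 stands for the cancelled all-zero tuple and avoids truncated subtraction.
  length-E : ∀ i → length (pos (E i)) + 1 ≡ 2 ^ i × length (neg (E i)) + 1 ≡ 2 ^ i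
  length-E zero = refl , refl
  length-E (suc i)
    rewrite length-prefixed (pos ∘ (E i ⟨ negate (D¹ i) , D² i ⟩))
          | length-prefixed (neg ∘ (E i ⟨ negate (D¹ i) , D² i ⟩))
    with p , q ← length-E i | p′ , q′ ← length-D i = double p p′ , double q q′
    where
    regroup : ∀ a b → a + b + 1 ≡ a + 1 + (b + 0)
    regroup = solve-∀
    double : ∀ {a b s} → a + 1 ≡ s → b ≡ s → a + b + 1 ≡ s + (s + 0)
    double {a} {b} p q = trans (regroup a b) (cong₂ (λ x y → x + (y + 0)) p q)

  -- The product of `m` factors 0 - 1 with `E i`.

  trade : (m i : ℕ) → Signed (m + i + r)
  trade zero    i = E i
  trade (suc m) i = [0−1]· trade m i

  trade-balanced : ∀ m i (j : Fin (m + i)) → Balanced (j ↑ˡ r) (trade m i)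
  trade-balanced zero    i j       = E-balanced i j
  trade-balanced (suc m) i zero    = [0−1]·-balanced-head (trade m i)
  trade-balanced (suc m) i (suc j) = [0−1]·-balanced {S = trade m i} (trade-balanced m i j)

  trade-disjoint : ∀ m i → DisjointSides (trade m i)
  trade-disjoint zero    i = E-disjoint i
  trade-disjoint (suc m) i = [0−1]·-disjoint {S = trade m i} (trade-disjoint m i)

  length-trade : ∀ m i → length (pos (trade m i)) + 2 ^ m ≡ 2 ^ (m + i) ×
                         length (neg (trade m i)) + 2 ^ m ≡ 2 ^ (m + i)
  length-trade zero    i = length-E i
  length-trade (suc m) i
    rewrite length-prefixed (pos ∘ (trade m i ⟨ negate (trade m i) , ∅ ⟩))
          | length-prefixed (neg ∘ (trade m i ⟨ negate (trade m i) , ∅ ⟩))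
    with p , q ← length-trade m i = double x y p q , double y x q p
    where
    x = length (pos (trade m i))
    y = length (neg (trade m i))
    regroup : ∀ a b s → a + (b + 0) + (s + (s + 0)) ≡ a + s + (b + s + 0)
    regroup = solve-∀
    double : ∀ a b {u} → a + 2 ^ m ≡ u → b + 2 ^ m ≡ u →
             a + (b + 0) + 2 ^ suc m ≡ u + (u + 0)
    double a b p q = trans (regroup a b (2 ^ m)) (cong₂ (λ x y → x + (y + 0)) p q)

-- From balance along single coordinates to Latin trades.

missed-point : ∀ {t d k} → t < d → (f : Fin t → Fin k) (g : Fin d → Fin k) →
               (∀ {a b} → g a ≡ g b → a ≡ b) → ∃[ j ] (∀ a → f a ≢ g j)
missed-point {d = d} t<d f g g-inj =
  let j , ¬hit = ¬∀⟶∃¬ d (λ j → ∃[ a ] f a ≡ g j) (λ j → any? (λ a → f a ≟ g j)) not-all-hit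
  in j , λ a eq → ¬hit (a , eq)
  where
  -- Choosing preimages would embed `Fin d` into the smaller `Fin t`.
  not-all-hit : (∀ j → ∃[ a ] f a ≡ g j) → _
  not-all-hit hit = <⇒notInjective {f = proj₁ ∘ hit} t<d λ {a} {b} eq →
    g-inj (trans (sym (proj₂ (hit a))) (trans (cong f eq) (proj₂ (hit b))))

latinTrade : ∀ {t} m i r → t < m + i → LatinTrade t 3 (m + i + r) (2 ^ (m + i) ∸ 2 ^ m)
latinTrade {t} m i r t<m+i = record
  { T₁       = pos (trade m i)
  ; T₂       = neg (trade m i)
  ; disjoint = trade-disjoint m i
  ; volume₁  = subtract (proj₁ (length-trade m i))
  ; volume₂  = subtract (proj₂ (length-trade m i))
  ; balanced = λ I u →
      -- Some balanced coordinate lies outside `I`, and containment is unaffected by overwriting it.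
      let j , missed = missed-point t<m+i (index I) (_↑ˡ r) (λ {a} {b} → ↑ˡ-injective r a b)
      in trade-balanced m i j (contains? I u)
           (λ x a x∋u l → trans (lookup∘update′ (missed l) x a) (x∋u l))
  }
  where
  open Construction r
  subtract : ∀ {a s u} → a + s ≡ u → a ≡ u ∸ s
  subtract {a} {s} refl = sym (m+n∸n≡m a s)

theorem1 : (t k : ℕ) → 1 ≤ t → t + 1 ≤ k →
    (i : ℕ) → i ≤ t + 1 →
    ∃[ v ] (1 ≤ v × LatinTrade t v k (2 ^ (t + 1) ∸ 2 ^ ((t + 1) ∸ i)))
theorem1 t k _ t+1≤k i i≤t+1 = 3 , s≤s z≤n ,
  subst (λ l → LatinTrade t 3 l (2 ^ (t + 1) ∸ 2 ^ m)) (m+[n∸m]≡n t+1≤k)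
    (subst (λ d → LatinTrade t 3 (d + r) (2 ^ d ∸ 2 ^ m)) m+i≡t+1
      (latinTrade m i r (≤-reflexive (trans (+-comm 1 t) (sym m+i≡t+1)))))
  where
  -- This leaves `t + 1` balanced coordinates, one more than a `t`-subset can cover; `i = 0` gives
  -- the trivial trade.
  m = (t + 1) ∸ i
  r = k ∸ (t + 1)
  m+i≡t+1 : m + i ≡ t + 1
  m+i≡t+1 = m∸n+n≡m i≤t+1
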